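{- Let $G$ be a graph having the strong Havel--Hakimi property. Then $R(G)=\alpha(G)$, where $R(G)$ is the residue of $G$ and $\alpha(G)$ is the independence number of $G$. Hence every application of the Maxine heuristic to $G$ (with any choices of maximum-degree vertices) produces a maximum independent set of $G$.
   Context: All graphs are finite and simple. A vertex $v$ of a graph $G$ has the Havel--Hakimi property (in $G$) if $v$ has maximum degree in $G$ and no vertex adjacent to $v$ has degree smaller than that of some vertex not adjacent to $v$; that is, $d_G(w)\ge d_G(u)$ for every neighbor $w$ of $v$ and every vertex $u\neq v$ not adjacent to $v$. A graph $G$ has the strong Havel--Hakimi property if in every induced subgraph $H$ of $G$, every vertex of maximum degree in $H$ has the Havel--Hakimi property in $H$. The Havel--Hakimi algorithm, applied to the degree sequence $d$ of a graph, iteratively removes a largest term $t$ from the current sequence and subtracts 1 from each of the $t$ largest remaining terms, re-sorting the terms from largest to smallest after each step, and stops when a list of zeroes is produced (for the degree sequence of a graph this always happens). The residue $R(d)$ is the number of zeroes in the final list; for a graph $G$ with degree sequence $d$, $R(G)=R(d)$. The Maxine heuristic, applied to a graph $G$: as long as the current graph contains at least one edge, choose a vertex of maximum degree in the current graph (arbitrarily if there are several) and delete it. The set of vertices remaining when no edges are left is an independent set of $G$, and is the set produced by the heuristic. -}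

module Defs where

open import Data.Fin.Base using (Fin)
open import Data.Fin.Properties using () renaming (all? to allVertices?)
open import Data.Fin.Subset using (Subset; _∈_; _⊆_; _∩_; ∁; ⁅_⁆; ∣_∣; inside; outside)
open import Data.Fin.Subset.Properties using (_∈?_; _⊆?_; x∈p∩q⁺)
open import Data.List.Base
  using (List; []; _∷_; _++_; map; filter; length; take; drop; allFin)
open import Data.List.Extrema.Nat using (max)
open import Data.List.Relation.Unary.All using (all?)
open import Data.Nat.Base using (ℕ; zero; suc; pred; _≤_)
open import Data.Nat.Properties using (_≟_; ≤-decTotalOrder)
open import Data.Product.Base using (∃₂; _×_; _,_)
import Data.Vec.Base as Vec
open import Level using (0ℓ)
open import Relation.Binary.Construct.Flip.EqAndOrd using (decTotalOrder)
open import Relation.Binary.Core using (Rel)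
open import Relation.Binary.Definitions using (Decidable; Symmetric; Irreflexive)
open import Relation.Binary.PropositionalEquality.Core using (_≡_; _≢_)
open import Relation.Nullary.Decidable using (Dec; does; yes; no; _×-dec_; _→-dec_; ¬?)
open import Relation.Nullary.Negation.Core using (¬_)

-- `sort` arranges a list of naturals from largest to smallest.
open import Data.List.Sort.InsertionSort (decTotalOrder ≤-decTotalOrder) using (sort)

-- The vertex set is an arbitrary subset of `Fin n`, so that induced subgraphs
-- and vertex-deleted subgraphs are again graphs of the same type.
record Graph (n : ℕ) : Set₁ where
  infix 4 _~_ _~?_
  field
    V        : Subset n
    _~_      : Rel (Fin n) 0ℓ
    _~?_     : Decidable _~_
    ~-sym    : Symmetric _~_
    ~-irrefl : Irreflexive _≡_ _~_
    ~⇒∈V     : ∀ {u v} → u ~ v → u ∈ V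

  N : Fin n → Subset n
  N v = Vec.tabulate (λ w → does (v ~? w))

  deg : Fin n → ℕ
  deg v = ∣ N v ∣

open Graph using (V; N; deg)

private
  variable
    n : ℕ

infix 8 _[_]

-- The subgraph induced by `V G ∩ S`.
_[_] : Graph n → Subset n → Graph n
G [ S ] = record
  { V        = G.V ∩ S
  ; _~_      = λ u v → u G.~ v × u ∈ S × v ∈ S
  ; _~?_     = λ u v → u G.~? v ×-dec u ∈? S ×-dec v ∈? S
  ; ~-sym    = λ (u~v , u∈S , v∈S) → G.~-sym u~v , v∈S , u∈S
  ; ~-irrefl = λ u≡v (u~v , _) → G.~-irrefl u≡v u~v
  ; ~⇒∈V     = λ (u~v , u∈S , _) → x∈p∩q⁺ (G.~⇒∈V u~v , u∈S)
  } where module G = Graph G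

deleteVertex : Graph n → Fin n → Graph n
deleteVertex G v = G [ ∁ ⁅ v ⁆ ]

HasMaxDegree : Graph n → Fin n → Set
HasMaxDegree G v = v ∈ V G × (∀ u → u ∈ V G → deg G u ≤ deg G v)

HavelHakimiProperty : Graph n → Fin n → Set
HavelHakimiProperty G v =
  HasMaxDegree G v ×
  (∀ w u → v ~ w → u ∈ V G → u ≢ v → ¬ v ~ u → deg G u ≤ deg G w)
  where open Graph G using (_~_)

StrongHavelHakimiProperty : Graph n → Set
StrongHavelHakimiProperty G =
  ∀ S v → HasMaxDegree (G [ S ]) v → HavelHakimiProperty (G [ S ]) v

-- One step on a list sorted from largest to smallest.  The truncations in
-- `pred` and `take` are never reached from the degree sequence of a graph.
havelHakimiStep : List ℕ → List ℕ
havelHakimiStep []       = []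
havelHakimiStep (t ∷ ds) = sort (map pred (take t ds) ++ drop t ds)

-- The first argument bounds the number of steps.  A step shortens a nonempty
-- list by one, so the length of the list is always a sufficient bound.
havelHakimi : ℕ → List ℕ → List ℕ
havelHakimi zero    ds = ds
havelHakimi (suc k) ds with all? (_≟ 0) ds
... | yes _ = ds
... | no  _ = havelHakimi k (havelHakimiStep ds)

residue : List ℕ → ℕ
residue ds = length (filter (_≟ 0) (havelHakimi (length ds) (sort ds)))

degreeSequence : Graph n → List ℕ
degreeSequence {n} G = sort (map (deg G) (filter (_∈? V G) (allFin n)))

R : Graph n → ℕ
R G = residue (degreeSequence G)

Independent : Graph n → Subset n → Set
Independent G S = S ⊆ V G × (∀ u v → u ∈ S → v ∈ S → ¬ u ~ v)
  where open Graph G using (_~_)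

independent? : (G : Graph n) (S : Subset n) → Dec (Independent G S)
independent? G S =
  S ⊆? V G ×-dec
  allVertices? (λ u → allVertices? (λ v → u ∈? S →-dec v ∈? S →-dec ¬? (u ~? v)))
  where open Graph G using (_~?_)

allSubsets : ∀ n → List (Subset n)
allSubsets zero    = Vec.[] ∷ []
allSubsets (suc n) =
  map (outside Vec.∷_) (allSubsets n) ++ map (inside Vec.∷_) (allSubsets n)

-- The default value 0 of `max` is attained, since the empty set is independent.
α : Graph n → ℕ
α {n} G = max 0 (map ∣_∣ (filter (independent? G) (allSubsets n)))

MaximumIndependent : Graph n → Subset n → Set
MaximumIndependent G S =
  Independent G S × (∀ T → Independent G T → ∣ T ∣ ≤ ∣ S ∣)

HasEdge : Graph n → Set
HasEdge G = ∃₂ λ u v → u ~ v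
  where open Graph G using (_~_)

-- `Maxine G S`: some run of the heuristic on `G` produces the set `S`.
data Maxine {n} (G : Graph n) : Subset n → Set where
  stop   : ¬ HasEdge G → Maxine G (V G)
  delete : ∀ {v S} → HasEdge G → HasMaxDegree G v →
           Maxine (deleteVertex G v) S → Maxine G S

{-# OPTIONS --safe #-}

-- A Havel–Hakimi step applied to the degree sequence of G deletes a vertex v with the
-- Havel–Hakimi property, so R is constant along a run of Maxine and equals the size of the
-- set produced.  It remains that deleting a vertex v of maximum degree does not decrease α.
-- Let v ∈ I with I independent, and let w be a neighbour of v.  If v is the only neighbour of
-- w in I, exchange v for w.  Otherwise w has another neighbour x in I, and since deg w ≤ deg v
-- some neighbour y ≠ w of v is not adjacent to w.  Again y may be assumed to have a neighbour
-- in I other than v.  The strong property for G[I ∪ {w, y}] then leaves x as the only such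
-- neighbour of both w and y, so {v, x} can be exchanged for {w, y}.

module Submission where

open import Defs
open import Data.Bool.Base using (true; false)
open import Data.Empty using (⊥)
open import Data.Fin.Base using (Fin; zero; suc)
open import Data.Fin.Properties using (_≟_; any?)
open import Data.Fin.Subset
  using (Subset; _∈_; _∉_; _⊆_; _∩_; _∪_; ∁; ⁅_⁆; ∣_∣; inside; outside)
  renaming (⊤ to ⊤ₛ)
open import Data.Fin.Subset.Properties
open import Data.List.Base
  using (List; []; _∷_; _++_; map; filter; length; take; drop; allFin; tabulate)
open import Data.List.Extrema.Nat using (argmax; argmax-all; f[xs]≤f[argmax]; max≈v⁺)
open import Data.List.Membership.Propositional using () renaming (_∈_ to _∈ₗ_)
open import Data.List.Membership.Propositional.Properties
  using (∈-filter⁺; ∈-filter⁻; ∈-allFin; ∈-map⁺; ∈-++⁺ˡ; ∈-++⁺ʳ; ∈-++⁻)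
open import Data.List.Membership.Propositional.Properties.WithK using (unique∧set⇒bag)
open import Data.List.Properties using (length-map; map-++; map-∘; filter-all)
open import Data.List.Relation.Binary.BagAndSetEquality using (∼bag⇒↭)
open import Data.List.Relation.Binary.Permutation.Propositional
  using (_↭_; ↭-sym; ↭-trans; ↭-prep; ↭⇒↭ₛ′)
open import Data.List.Relation.Binary.Permutation.Propositional.Properties as Perm
  using (All-resp-↭; ↭-length)
import Data.List.Relation.Binary.Pointwise as Pointwise
open import Data.List.Relation.Unary.All as All using (All; []; _∷_; all?)
import Data.List.Relation.Unary.All.Properties as All
open import Data.List.Relation.Unary.AllPairs using ([]; _∷_)
import Data.List.Relation.Unary.AllPairs.Properties as AllPairs
open import Data.List.Relation.Unary.Any using (here; there)
import Data.List.Relation.Unary.Sorted.TotalOrder as Sorted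
open import Data.List.Relation.Unary.Sorted.TotalOrder.Properties
  using (↗↭↗⇒≋; AllPairs⇒Sorted; Sorted⇒AllPairs)
open import Data.List.Relation.Unary.Unique.Propositional using (Unique)
import Data.List.Relation.Unary.Unique.Propositional.Properties as Unique
open import Data.List.Sort.Base using (SortingAlgorithm)
open import Data.Nat.Base using (ℕ; zero; suc; pred; _+_; _≤_; _<_; z≤n; s≤s)
open import Data.Nat.Properties
  using (≤-refl; ≤-reflexive; ≤-trans; ≤-antisym; ≤-total; +-suc; +-monoʳ-≤; n≤1+n; 1+n≰n;
         ≤-decTotalOrder; module ≤-Reasoning)
  renaming (_≟_ to _≟ℕ_)
open import Data.Product.Base using (∃; _×_; _,_; proj₁; proj₂)
open import Data.Sum.Base using (_⊎_; inj₁; inj₂; [_,_]′; swap)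
import Data.Vec.Base as Vec
open import Data.Vec.Properties using (lookup∘tabulate; []=⇒lookup; lookup⇒[]=)
open import Function.Base using (_∘_)
open import Function.Bundles using (mk⇔)
open import Relation.Binary.Bundles using (DecTotalOrder)
open import Relation.Binary.Construct.Flip.EqAndOrd using (decTotalOrder)
open import Relation.Binary.PropositionalEquality
  using (_≡_; _≢_; refl; sym; trans; cong; cong₂; subst)
open import Relation.Nullary.Decidable
  using (Dec; does; yes; no; _×-dec_; ¬?; dec-true; decidable-stable)
open import Relation.Nullary.Negation.Core using (¬_; contradiction)
open import Relation.Unary using (Decidable)

open import Data.List.Sort.InsertionSort (decTotalOrder ≤-decTotalOrder)
  using (sort; insertionSort)
open SortingAlgorithm insertionSort using (sort-↭; sort-↗)

open Graph using (V; N; deg)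

private
  variable
    n : ℕ

-- Finite subsets and their cardinalities.

infixl 7 _∖_

-- Spelled out in this form so that `V (deleteVertex G v)` is `V G ∖ v` by definition.
_∖_ : Subset n → Fin n → Subset n
p ∖ v = p ∩ ∁ ⁅ v ⁆

∈∁⁅⁆⁺ : {u v : Fin n} → u ≢ v → u ∈ ∁ ⁅ v ⁆
∈∁⁅⁆⁺ u≢v = x∉p⇒x∈∁p (x≢y⇒x∉⁅y⁆ u≢v)

∈∁⁅⁆⁻ : {u v : Fin n} → u ∈ ∁ ⁅ v ⁆ → u ≢ v
∈∁⁅⁆⁻ u∈ = x∉⁅y⁆⇒x≢y (x∈∁p⇒x∉p u∈)

∈∖⁺ : {p : Subset n} {u v : Fin n} → u ∈ p → u ≢ v → u ∈ p ∖ v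
∈∖⁺ u∈p u≢v = x∈p∩q⁺ (u∈p , ∈∁⁅⁆⁺ u≢v)

∈∖⁻ : {p : Subset n} {u v : Fin n} → u ∈ p ∖ v → u ∈ p × u ≢ v
∈∖⁻ {p = p} {v = v} u∈ with x∈p∩q⁻ p (∁ ⁅ v ⁆) u∈
... | u∈p , u∈∁ = u∈p , ∈∁⁅⁆⁻ u∈∁

p∖v⊆p : (p : Subset n) (v : Fin n) → p ∖ v ⊆ p
p∖v⊆p p v = p∩q⊆p p (∁ ⁅ v ⁆)

v∉p∖v : (p : Subset n) (v : Fin n) → v ∉ p ∖ v
v∉p∖v p v v∈ = proj₂ (∈∖⁻ {p = p} v∈) refl

∈⁅⁆∪⁺ˡ : (w : Fin n) {p : Subset n} → w ∈ ⁅ w ⁆ ∪ p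
∈⁅⁆∪⁺ˡ w = x∈p∪q⁺ (inj₁ (x∈⁅x⁆ w))

∈⁅⁆∪⁺ʳ : {w u : Fin n} {p : Subset n} → u ∈ p → u ∈ ⁅ w ⁆ ∪ p
∈⁅⁆∪⁺ʳ u∈p = x∈p∪q⁺ (inj₂ u∈p)

∈⁅⁆∪⁻ : {w u : Fin n} {p : Subset n} → u ∈ ⁅ w ⁆ ∪ p → u ≡ w ⊎ u ∈ p
∈⁅⁆∪⁻ {w = w} {p = p} u∈ with x∈p∪q⁻ ⁅ w ⁆ p u∈
... | inj₁ u∈⁅w⁆ = inj₁ (x∈⁅y⁆⇒x≡y w u∈⁅w⁆)
... | inj₂ u∈p   = inj₂ u∈p

∣p∪q∣≤∣p∣+∣q∣ : (p q : Subset n) → ∣ p ∪ q ∣ ≤ ∣ p ∣ + ∣ q ∣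
∣p∪q∣≤∣p∣+∣q∣ Vec.[]              Vec.[]              = z≤n
∣p∪q∣≤∣p∣+∣q∣ (outside Vec.∷ p) (outside Vec.∷ q) = ∣p∪q∣≤∣p∣+∣q∣ p q
∣p∪q∣≤∣p∣+∣q∣ (outside Vec.∷ p) (inside Vec.∷ q)
  rewrite +-suc ∣ p ∣ ∣ q ∣ = s≤s (∣p∪q∣≤∣p∣+∣q∣ p q)
∣p∪q∣≤∣p∣+∣q∣ (inside Vec.∷ p) (outside Vec.∷ q) = s≤s (∣p∪q∣≤∣p∣+∣q∣ p q)
∣p∪q∣≤∣p∣+∣q∣ (inside Vec.∷ p) (inside Vec.∷ q) =
  s≤s (≤-trans (∣p∪q∣≤∣p∣+∣q∣ p q) (+-monoʳ-≤ ∣ p ∣ (n≤1+n ∣ q ∣)))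

∣⁅v⁆∪p∣≤1+∣p∣ : (v : Fin n) (p : Subset n) → ∣ ⁅ v ⁆ ∪ p ∣ ≤ suc ∣ p ∣
∣⁅v⁆∪p∣≤1+∣p∣ v p = ≤-trans (∣p∪q∣≤∣p∣+∣q∣ ⁅ v ⁆ p) (≤-reflexive (cong (_+ ∣ p ∣) (∣⁅x⁆∣≡1 v)))

v∉p⇒∣p∣<∣⁅v⁆∪p∣ : {v : Fin n} {p : Subset n} → v ∉ p → ∣ p ∣ < ∣ ⁅ v ⁆ ∪ p ∣
v∉p⇒∣p∣<∣⁅v⁆∪p∣ {v = v} v∉p = p⊂q⇒∣p∣<∣q∣ (∈⁅⁆∪⁺ʳ , v , ∈⁅⁆∪⁺ˡ v , v∉p)

v∈p⇒∣p∖v∣<∣p∣ : {v : Fin n} {p : Subset n} → v ∈ p → ∣ p ∖ v ∣ < ∣ p ∣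
v∈p⇒∣p∖v∣<∣p∣ {v = v} {p} v∈p =
  p⊂q⇒∣p∣<∣q∣ (p∖v⊆p p v , v , v∈p , v∉p∖v p v)

∣p∣≤1+∣p∖v∣ : (p : Subset n) (v : Fin n) → ∣ p ∣ ≤ suc ∣ p ∖ v ∣
∣p∣≤1+∣p∖v∣ p v = ≤-trans (p⊆q⇒∣p∣≤∣q∣ p⊆) (∣⁅v⁆∪p∣≤1+∣p∣ v (p ∖ v))
  where
  p⊆ : p ⊆ ⁅ v ⁆ ∪ p ∖ v
  p⊆ {u} u∈p with u ≟ v
  ... | yes refl = ∈⁅⁆∪⁺ˡ v
  ... | no u≢v   = ∈⁅⁆∪⁺ʳ (∈∖⁺ u∈p u≢v)

-- The source of upper bounds on degrees: `xs` only has to cover `p` and may contain repetitions or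
-- other elements. Removing the head of `xs` from `p` lowers the cardinality by at most one.
∣p∣≤length : {p : Subset n} (xs : List (Fin n)) → (∀ {u} → u ∈ p → u ∈ₗ xs) → ∣ p ∣ ≤ length xs
∣p∣≤length {n} {p} [] p⊆[] =
  ≤-reflexive (trans (cong ∣_∣ (Empty-unique λ (_ , u∈p) → ∉[] (p⊆[] u∈p))) (∣⊥∣≡0 n))
  where
  ∉[] : {u : Fin n} → ¬ u ∈ₗ []
  ∉[] ()
∣p∣≤length {p = p} (x ∷ xs) p⊆ =
  ≤-trans (∣p∣≤1+∣p∖v∣ p x) (s≤s (∣p∣≤length xs p∖x⊆xs))
  where
  tail∈ : ∀ {u} → u ≢ x → u ∈ₗ x ∷ xs → u ∈ₗ xs
  tail∈ u≢x (here u≡x)  = contradiction u≡x u≢x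
  tail∈ u≢x (there u∈)  = u∈
  p∖x⊆xs : ∀ {u} → u ∈ p ∖ x → u ∈ₗ xs
  p∖x⊆xs u∈ = tail∈ (proj₂ (∈∖⁻ {p = p} u∈)) (p⊆ (p∖v⊆p p x u∈))

-- The source of lower bounds on degrees: as the entries are distinct, each one removed from `p`
-- leaves the later ones in place and strictly lowers the cardinality.
length≤∣p∣ : {p : Subset n} {xs : List (Fin n)} → Unique xs → All (_∈ p) xs → length xs ≤ ∣ p ∣
length≤∣p∣ [] [] = z≤n
length≤∣p∣ (x∉xs ∷ xs!) (x∈p ∷ xs⊆p) =
  ≤-trans (s≤s (length≤∣p∣ xs! (All.zipWith (λ (x≢u , u∈p) → ∈∖⁺ u∈p (x≢u ∘ sym)) (x∉xs , xs⊆p))))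
          (v∈p⇒∣p∖v∣<∣p∣ x∈p)

module _ {P : Fin n → Set} (P? : Decidable P) where

  ∈-tabulate⁺ : ∀ {i} → P i → i ∈ Vec.tabulate (does ∘ P?)
  ∈-tabulate⁺ {i} Pi = lookup⇒[]= i _ (trans (lookup∘tabulate (does ∘ P?) i) (dec-true (P? i) Pi))

  ∈-tabulate⁻ : ∀ {i} → i ∈ Vec.tabulate (does ∘ P?) → P i
  ∈-tabulate⁻ {i} i∈ with P? i | trans (sym (lookup∘tabulate (does ∘ P?) i)) ([]=⇒lookup i∈)
  ... | yes Pi | _ = Pi

-- Stated for an arbitrary `f`, because the recursion on `n` replaces `f` by `f ∘ suc`. With `f` the
-- identity it counts vertices and neighbours.
length-filter-tabulate : {A : Set} {P : A → Set} (P? : Decidable P) (f : Fin n → A) →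
                         length (filter P? (tabulate f)) ≡ ∣ Vec.tabulate (does ∘ P? ∘ f) ∣
length-filter-tabulate {zero}  P? f = refl
length-filter-tabulate {suc n} P? f with does (P? (f zero))
... | true  = cong suc (length-filter-tabulate P? (f ∘ suc))
... | false = length-filter-tabulate P? (f ∘ suc)

-- Degrees, neighbours and independent sets in a graph.

module _ (G : Graph n) where
  open Graph G using (_~_; _~?_; ~-sym; ~-irrefl; ~⇒∈V)

  ∈N⁺ : ∀ {u v} → v ~ u → u ∈ N G v
  ∈N⁺ {v = v} = ∈-tabulate⁺ (v ~?_)

  ∈N⁻ : ∀ {u v} → u ∈ N G v → v ~ u
  ∈N⁻ {v = v} = ∈-tabulate⁻ (v ~?_)

  deg≤length : ∀ {v} (xs : List (Fin n)) → (∀ {u} → v ~ u → u ∈ₗ xs) → deg G v ≤ length xs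
  deg≤length xs nbrs⊆ = ∣p∣≤length xs (λ u∈N → nbrs⊆ (∈N⁻ u∈N))

  length≤deg : ∀ {v xs} → Unique xs → All (v ~_) xs → length xs ≤ deg G v
  length≤deg xs! v~xs = length≤∣p∣ xs! (All.map ∈N⁺ v~xs)

  hasEdge? : Dec (HasEdge G)
  hasEdge? = any? (λ u → any? (λ v → u ~? v))

  vertices : List (Fin n)
  vertices = filter (_∈? V G) (allFin n)

  degrees : List ℕ
  degrees = map (deg G) vertices

  maxDegreeVertex : ∀ {u} → u ∈ V G → ∃ (HasMaxDegree G)
  maxDegreeVertex {u} u∈V = argmax (deg G) u vertices ,
    argmax-all (deg G) u∈V (All.all-filter (_∈? V G) (allFin n)) ,
    λ x x∈V → All.lookup (f[xs]≤f[argmax] u vertices) (∈-filter⁺ (_∈? V G) (∈-allFin x) x∈V)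

  -- An isolated `v` would have degree 0, while an end of an edge has degree at least 1.
  maxDegreeNeighbour : ∀ {v} → HasMaxDegree G v → HasEdge G → ∃ λ w → v ~ w
  maxDegreeNeighbour {v} (_ , v-max) (a , b , a~b) with any? (v ~?_)
  ... | yes nbr = nbr
  ... | no isolated = contradiction
        (≤-trans (length≤deg ([] ∷ []) (a~b ∷ []))
          (≤-trans (v-max a (~⇒∈V a~b)) (deg≤length [] (λ v~u → contradiction (_ , v~u) isolated))))
        1+n≰n

  -- Otherwise N(w) contains v, x and N(v) ∖ w, so w has larger degree than v.
  neighbourAvoiding : ∀ {v w x} → HasMaxDegree G v → v ~ w → w ~ x → x ≢ v → ¬ v ~ x →
                      ∃ λ y → v ~ y × y ≢ w × ¬ w ~ y
  neighbourAvoiding {v} {w} {x} (_ , v-max) v~w w~x x≢v v≁x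
    with any? (λ y → v ~? y ×-dec ¬? (y ≟ w) ×-dec ¬? (w ~? y))
  ... | yes found = found
  ... | no none   = contradiction 1+deg≤deg 1+n≰n
    where
    q = ⁅ v ⁆ ∪ N G v ∖ w
    v∉ : v ∉ N G v ∖ w
    v∉ v∈ = ~-irrefl refl (∈N⁻ (proj₁ (∈∖⁻ v∈)))
    x∉q : x ∉ q
    x∉q x∈q with ∈⁅⁆∪⁻ x∈q
    ... | inj₁ x≡v = x≢v x≡v
    ... | inj₂ x∈  = v≁x (∈N⁻ (proj₁ (∈∖⁻ x∈)))
    ⊆Nw : ⁅ x ⁆ ∪ q ⊆ N G w
    ⊆Nw u∈ with ∈⁅⁆∪⁻ u∈
    ... | inj₁ refl = ∈N⁺ w~x
    ... | inj₂ u∈q with ∈⁅⁆∪⁻ u∈q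
    ...   | inj₁ refl = ∈N⁺ (~-sym v~w)
    ...   | inj₂ u∈′ with ∈∖⁻ u∈′
    ...     | u∈N , u≢w = ∈N⁺ (decidable-stable (w ~? _) λ w≁u → none (_ , ∈N⁻ u∈N , u≢w , w≁u))
    open ≤-Reasoning
    1+deg≤deg : suc (deg G v) ≤ deg G v
    1+deg≤deg = begin
      suc (deg G v)            ≤⟨ s≤s (∣p∣≤1+∣p∖v∣ (N G v) w) ⟩
      suc (suc ∣ N G v ∖ w ∣)  ≤⟨ s≤s (v∉p⇒∣p∣<∣⁅v⁆∪p∣ v∉) ⟩
      suc ∣ q ∣                ≤⟨ v∉p⇒∣p∣<∣⁅v⁆∪p∣ x∉q ⟩
      ∣ ⁅ x ⁆ ∪ q ∣            ≤⟨ p⊆q⇒∣p∣≤∣q∣ ⊆Nw ⟩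
      deg G w                  ≤⟨ v-max w (~⇒∈V (~-sym v~w)) ⟩
      deg G v                  ∎

  independent-∪ : ∀ {w I} → w ∈ V G → Independent G I → (∀ {u} → u ∈ I → ¬ w ~ u) →
                  Independent G (⁅ w ⁆ ∪ I)
  independent-∪ {w} {I} w∈V (I⊆V , I-indep) w≁I = ⊆V , indep
    where
    ⊆V : ⁅ w ⁆ ∪ I ⊆ V G
    ⊆V u∈ with ∈⁅⁆∪⁻ u∈
    ... | inj₁ refl = w∈V
    ... | inj₂ u∈I  = I⊆V u∈I
    indep : ∀ a b → a ∈ ⁅ w ⁆ ∪ I → b ∈ ⁅ w ⁆ ∪ I → ¬ a ~ b
    indep a b a∈ b∈ a~b with ∈⁅⁆∪⁻ a∈ | ∈⁅⁆∪⁻ b∈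
    ... | inj₁ refl | inj₁ refl = ~-irrefl refl a~b
    ... | inj₁ refl | inj₂ b∈I  = w≁I b∈I a~b
    ... | inj₂ a∈I  | inj₁ refl = w≁I a∈I (~-sym a~b)
    ... | inj₂ a∈I  | inj₂ b∈I  = I-indep a b a∈I b∈I a~b

  independent-⊆ : ∀ {I J} → J ⊆ I → Independent G I → Independent G J
  independent-⊆ J⊆I (I⊆V , I-indep) =
    (λ u∈J → I⊆V (J⊆I u∈J)) , λ a b a∈J b∈J → I-indep a b (J⊆I a∈J) (J⊆I b∈J)

  independent-∖ : ∀ {I} v → Independent G I → Independent G (I ∖ v)
  independent-∖ v = independent-⊆ (p∖v⊆p _ v)

  independent-delete⁺ : ∀ {v I} → v ∉ I → Independent G I → Independent (deleteVertex G v) I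
  independent-delete⁺ v∉I (I⊆V , I-indep) =
    (λ u∈I → ∈∖⁺ (I⊆V u∈I) λ { refl → v∉I u∈I }) ,
    λ a b a∈I b∈I (a~b , _) → I-indep a b a∈I b∈I a~b

  independent-delete⁻ : ∀ {v I} → Independent (deleteVertex G v) I → Independent G I
  independent-delete⁻ (I⊆V , I-indep) =
    (λ u∈I → proj₁ (∈∖⁻ (I⊆V u∈I))) ,
    λ a b a∈I b∈I a~b → I-indep a b a∈I b∈I
      (a~b , ∈∁⁅⁆⁺ (proj₂ (∈∖⁻ (I⊆V a∈I))) , ∈∁⁅⁆⁺ (proj₂ (∈∖⁻ (I⊆V b∈I))))

-- Equality of labelled graphs and heredity of the strong property.

infix 4 _≅_

-- The identity map on `Fin n` as an isomorphism. Adjacency is only required to be equivalent, since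
-- restricting twice and restricting once to the intersection give different, though equivalent,
-- adjacency types.
record _≅_ (G H : Graph n) : Set where
  field
    V≡  : V G ≡ V H
    ~⇒~ : ∀ {u v} → Graph._~_ G u v → Graph._~_ H u v
    ~⇐~ : ∀ {u v} → Graph._~_ H u v → Graph._~_ G u v

  N≡ : ∀ v → N G v ≡ N H v
  N≡ v = ⊆-antisym (λ u∈ → ∈N⁺ H (~⇒~ (∈N⁻ G u∈))) (λ u∈ → ∈N⁺ G (~⇐~ (∈N⁻ H u∈)))

  deg≡ : ∀ v → deg G v ≡ deg H v
  deg≡ v = cong ∣_∣ (N≡ v)

open _≅_

≅-sym : {G H : Graph n} → G ≅ H → H ≅ G
≅-sym e = record { V≡ = sym (V≡ e) ; ~⇒~ = ~⇐~ e ; ~⇐~ = ~⇒~ e }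

maxDegree-resp-≅ : {G H : Graph n} → G ≅ H → ∀ {v} → HasMaxDegree G v → HasMaxDegree H v
maxDegree-resp-≅ e {v} (v∈V , v-max) rewrite sym (V≡ e) =
  v∈V , λ u u∈V → ≤-trans (≤-reflexive (sym (deg≡ e u)))
    (≤-trans (v-max u u∈V) (≤-reflexive (deg≡ e v)))

havelHakimi-resp-≅ : {G H : Graph n} → G ≅ H → ∀ {v} →
                     HavelHakimiProperty G v → HavelHakimiProperty H v
havelHakimi-resp-≅ e (v-max , dominates) =
  maxDegree-resp-≅ e v-max ,
  λ w u v~w u∈V u≢v v≁u → ≤-trans (≤-reflexive (sym (deg≡ e u)))
    (≤-trans (dominates w u (~⇐~ e v~w) (subst (u ∈_) (sym (V≡ e)) u∈V) u≢v (v≁u ∘ ~⇒~ e))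
      (≤-reflexive (deg≡ e w)))

[]-∩ : (G : Graph n) (S T : Subset n) → (G [ S ]) [ T ] ≅ G [ S ∩ T ]
[]-∩ G S T = record
  { V≡  = ∩-assoc (V G) S T
  ; ~⇒~ = λ ((u~v , u∈S , v∈S) , u∈T , v∈T) → u~v , x∈p∩q⁺ (u∈S , u∈T) , x∈p∩q⁺ (v∈S , v∈T)
  ; ~⇐~ = λ (u~v , u∈ , v∈) →
      (u~v , proj₁ (x∈p∩q⁻ S T u∈) , proj₁ (x∈p∩q⁻ S T v∈)) ,
      proj₂ (x∈p∩q⁻ S T u∈) , proj₂ (x∈p∩q⁻ S T v∈)
  }

[⊤] : (G : Graph n) → G [ ⊤ₛ ] ≅ G
[⊤] G = record
  { V≡ = ∩-identityʳ (V G) ; ~⇒~ = proj₁ ; ~⇐~ = λ u~v → u~v , ∈⊤ , ∈⊤ }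

-- Induced subgraphs of `G [ S ]` are induced subgraphs of `G`, on `S ∩ T`. This keeps the
-- hypothesis available after each deletion in a run of Maxine.
strong-[] : {G : Graph n} → StrongHavelHakimiProperty G → ∀ S → StrongHavelHakimiProperty (G [ S ])
strong-[] {G = G} strong S T v v-max = havelHakimi-resp-≅ (≅-sym ([]-∩ G S T))
  (strong (S ∩ T) v (maxDegree-resp-≅ ([]-∩ G S T) v-max))

strong⇒havelHakimi : {G : Graph n} → StrongHavelHakimiProperty G →
                     ∀ {v} → HasMaxDegree G v → HavelHakimiProperty G v
strong⇒havelHakimi {G = G} strong v-max = havelHakimi-resp-≅ ([⊤] G)
  (strong ⊤ₛ _ (maxDegree-resp-≅ (≅-sym ([⊤] G)) v-max))

-- Exchange arguments for a deleted vertex of maximum degree.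

module _ {G : Graph n} (strong : StrongHavelHakimiProperty G) where
  open Graph G using (_~_; _~?_; ~-sym; ~-irrefl; ~⇒∈V)

  module _ {I w y} (I-indep : Independent G I) (w∈V : w ∈ V G) (y∈V : y ∈ V G)
           (w≢y : w ≢ y) (w≁y : ¬ w ~ y) where

    private
      S = ⁅ w ⁆ ∪ (⁅ y ⁆ ∪ I)
      H = G [ S ]
      module H = Graph H

      w∈S : w ∈ S
      w∈S = ∈⁅⁆∪⁺ˡ w

      y∈S : y ∈ S
      y∈S = ∈⁅⁆∪⁺ʳ (∈⁅⁆∪⁺ˡ y)

      I⊆S : I ⊆ S
      I⊆S u∈I = ∈⁅⁆∪⁺ʳ (∈⁅⁆∪⁺ʳ u∈I)

      ∈S⁻ : ∀ {u} → u ∈ S → (u ≡ w ⊎ u ≡ y) ⊎ u ∈ I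
      ∈S⁻ u∈S with ∈⁅⁆∪⁻ u∈S
      ... | inj₁ u≡w = inj₁ (inj₁ u≡w)
      ... | inj₂ u∈ with ∈⁅⁆∪⁻ u∈
      ...   | inj₁ u≡y = inj₁ (inj₂ u≡y)
      ...   | inj₂ u∈I = inj₂ u∈I

      -- In G[I ∪ {w, y}] the larger of the degrees of w and y is maximal, and the
      -- Havel–Hakimi property at that vertex makes its neighbours in I adjacent to both.
      no-two-branches-≤ : ∀ {p q v x z} → (∀ {u} → u ∈ S → (u ≡ p ⊎ u ≡ q) ⊎ u ∈ I) →
        p ∈ S → q ∈ S → p ∈ V G → q ∈ V G → p ≢ q → ¬ p ~ q →
        v ∈ I → x ∈ I → z ∈ I → v ≢ x → v ≢ z → x ≢ z →
        p ~ v → p ~ x → q ~ v → q ~ z → ¬ deg H q ≤ deg H p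
      no-two-branches-≤ {p} {q} {v} {x} {z} S⁻ p∈S q∈S p∈V q∈V p≢q p≁q
        v∈I x∈I z∈I v≢x v≢z x≢z p~v p~x q~v q~z dq≤dp = bad (q ~? x)
        where
        I-deg≤2 : ∀ {u} → u ∈ I → deg H u ≤ 2
        I-deg≤2 {u} u∈I = deg≤length H (p ∷ q ∷ []) nbrs
          where
          nbrs : ∀ {t} → u H.~ t → t ∈ₗ p ∷ q ∷ []
          nbrs {t} (u~t , _ , t∈S) with S⁻ t∈S
          ... | inj₁ (inj₁ t≡p) = here t≡p
          ... | inj₁ (inj₂ t≡q) = there (here t≡q)
          ... | inj₂ t∈I = contradiction u~t (proj₂ I-indep u t u∈I t∈I)
        2≤dp : 2 ≤ deg H p
        2≤dp = length≤deg H ((v≢x ∷ []) ∷ ([] ∷ []))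
          ((p~v , p∈S , I⊆S v∈I) ∷ (p~x , p∈S , I⊆S x∈I) ∷ [])
        2≤dq : 2 ≤ deg H q
        2≤dq = length≤deg H ((v≢z ∷ []) ∷ ([] ∷ []))
          ((q~v , q∈S , I⊆S v∈I) ∷ (q~z , q∈S , I⊆S z∈I) ∷ [])
        p-max : HasMaxDegree H p
        p-max = x∈p∩q⁺ (p∈V , p∈S) , maximal
          where
          maximal : ∀ u → u ∈ V H → deg H u ≤ deg H p
          maximal u u∈V with S⁻ (proj₂ (x∈p∩q⁻ (V G) S u∈V))
          ... | inj₁ (inj₁ refl) = ≤-refl
          ... | inj₁ (inj₂ refl) = dq≤dp
          ... | inj₂ u∈I = ≤-trans (I-deg≤2 u∈I) 2≤dp
        dq≤dx : deg H q ≤ deg H x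
        dq≤dx = proj₂ (strong S p p-max) x q (p~x , p∈S , I⊆S x∈I)
          (x∈p∩q⁺ (q∈V , q∈S)) (p≢q ∘ sym) (p≁q ∘ proj₁)
        -- The bound `dq≤dx` fails either way. If `q ~ x`, then `q` has the three neighbours `v`,
        -- `x`, `z`, but `x` has degree at most 2. If not, `p` is the only possible neighbour of `x`
        -- in `H`, but `q` has degree at least 2.
        bad : Dec (q ~ x) → ⊥
        bad (yes q~x) = contradiction (≤-trans 3≤dq (≤-trans dq≤dx (I-deg≤2 x∈I))) 1+n≰n
          where
          3≤dq : 3 ≤ deg H q
          3≤dq = length≤deg H
            ((v≢x ∷ v≢z ∷ []) ∷ ((x≢z ∷ []) ∷ ([] ∷ [])))
            ((q~v , q∈S , I⊆S v∈I) ∷ (q~x , q∈S , I⊆S x∈I) ∷ (q~z , q∈S , I⊆S z∈I) ∷ [])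
        bad (no q≁x) = contradiction (≤-trans 2≤dq (≤-trans dq≤dx dx≤1)) 1+n≰n
          where
          nbrs : ∀ {t} → x H.~ t → t ∈ₗ p ∷ []
          nbrs {t} (x~t , _ , t∈S) with S⁻ t∈S
          ... | inj₁ (inj₁ t≡p)  = here t≡p
          ... | inj₁ (inj₂ refl) = contradiction (~-sym x~t) q≁x
          ... | inj₂ t∈I = contradiction x~t (proj₂ I-indep x t x∈I t∈I)
          dx≤1 : deg H x ≤ 1
          dx≤1 = deg≤length H (p ∷ []) nbrs

    -- The situation is symmetric under exchanging `w` with `y` and `x` with `z`, so whichever of
    -- `w` and `y` has the larger degree in `H` can play the role of `p`.
    no-two-branches : ∀ {v x z} → v ∈ I → x ∈ I → z ∈ I → v ≢ x → v ≢ z → x ≢ z →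
      w ~ v → w ~ x → y ~ v → y ~ z → ⊥
    no-two-branches v∈I x∈I z∈I v≢x v≢z x≢z w~v w~x y~v y~z with ≤-total (deg H y) (deg H w)
    ... | inj₁ dy≤dw = no-two-branches-≤ ∈S⁻ w∈S y∈S w∈V y∈V w≢y w≁y
            v∈I x∈I z∈I v≢x v≢z x≢z w~v w~x y~v y~z dy≤dw
    ... | inj₂ dw≤dy = no-two-branches-≤ (λ u∈S → [ inj₁ ∘ swap , inj₂ ]′ (∈S⁻ u∈S))
            y∈S w∈S y∈V w∈V (w≢y ∘ sym) (w≁y ∘ ~-sym)
            v∈I z∈I x∈I v≢z v≢x (x≢z ∘ sym) y~v y~z w~v w~x dw≤dy

  module _ {v I} (v-max : HasMaxDegree G v) (I-indep : Independent G I) (v∈I : v ∈ I) where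

    private
      I-free = proj₂ I-indep

      ∈V : ∀ {w} → v ~ w → w ∈ V G
      ∈V v~w = ~⇒∈V (~-sym v~w)

      ∉I : ∀ {w} → v ~ w → w ∉ I
      ∉I v~w w∈I = I-free v _ v∈I w∈I v~w

      ~⇒≢ : ∀ {w} → v ~ w → v ≢ w
      ~⇒≢ v~w v≡w = ~-irrefl v≡w v~w

    Exchange : Set
    Exchange = ∃ λ J → Independent (deleteVertex G v) J × ∣ I ∣ ≤ ∣ J ∣

    exchangeOne : ∀ {w} → v ~ w → ¬ (∃ λ x → x ∈ I × x ≢ v × w ~ x) → Exchange
    exchangeOne {w} v~w noOther =
      ⁅ w ⁆ ∪ I ∖ v ,
      independent-delete⁺ G v∉J
        (independent-∪ G (∈V v~w) (independent-∖ G v I-indep)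
          λ u∈ w~u → noOther (_ , proj₁ (∈∖⁻ u∈) , proj₂ (∈∖⁻ u∈) , w~u)) ,
      ≤-trans (∣p∣≤1+∣p∖v∣ I v) (v∉p⇒∣p∣<∣⁅v⁆∪p∣ λ w∈ → ∉I v~w (proj₁ (∈∖⁻ w∈)))
      where
      v∉J : v ∉ ⁅ w ⁆ ∪ I ∖ v
      v∉J v∈J with ∈⁅⁆∪⁻ v∈J
      ... | inj₁ v≡w = ~⇒≢ v~w v≡w
      ... | inj₂ v∈  = v∉p∖v I v v∈

    -- By `no-two-branches` the neighbours other than `v` that `w` and `y` have in `I` all coincide,
    -- so `x` is in fact `z`, and removing `v` and `x` makes room for both `w` and `y`.
    exchangeTwo : ∀ {w y x z} → v ~ w → v ~ y → y ≢ w → ¬ w ~ y →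
                  x ∈ I → x ≢ v → w ~ x → z ∈ I → z ≢ v → y ~ z → Exchange
    exchangeTwo {w} {y} {x} {z} v~w v~y y≢w w≁y x∈I x≢v w~x z∈I z≢v y~z =
      J , independent-delete⁺ G v∉J J-indep , ∣I∣≤∣J∣
      where
      K = I ∖ v ∖ x
      J = ⁅ w ⁆ ∪ (⁅ y ⁆ ∪ K)

      K⁻ : ∀ {u} → u ∈ K → u ∈ I × u ≢ v × u ≢ x
      K⁻ u∈ = proj₁ (∈∖⁻ (proj₁ (∈∖⁻ u∈))) , proj₂ (∈∖⁻ (proj₁ (∈∖⁻ u∈))) , proj₂ (∈∖⁻ u∈)

      v∉J : v ∉ J
      v∉J v∈J with ∈⁅⁆∪⁻ v∈J
      ... | inj₁ v≡w = ~⇒≢ v~w v≡w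
      ... | inj₂ v∈ with ∈⁅⁆∪⁻ v∈
      ...   | inj₁ v≡y = ~⇒≢ v~y v≡y
      ...   | inj₂ v∈K = proj₁ (proj₂ (K⁻ v∈K)) refl

      two-branches : ∀ {a b} → a ∈ I → a ≢ v → w ~ a → b ∈ I → b ≢ v → y ~ b → a ≢ b → ⊥
      two-branches a∈I a≢v w~a b∈I b≢v y~b a≢b =
        no-two-branches I-indep (∈V v~w) (∈V v~y) (y≢w ∘ sym) w≁y
          v∈I a∈I b∈I (a≢v ∘ sym) (b≢v ∘ sym) a≢b (~-sym v~w) w~a (~-sym v~y) y~b

      y≁K : ∀ {u} → u ∈ K → ¬ y ~ u
      y≁K u∈K y~u with K⁻ u∈K
      ... | u∈I , u≢v , u≢x = two-branches x∈I x≢v w~x u∈I u≢v y~u (u≢x ∘ sym)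

      w≁K : ∀ {u} → u ∈ K → ¬ w ~ u
      w≁K {u} u∈K w~u with K⁻ u∈K | u ≟ z
      ... | u∈I , u≢v , u≢x | no u≢z   = two-branches u∈I u≢v w~u z∈I z≢v y~z u≢z
      -- With `u` equal to `z` the pair `u`, `z` is not a pair of distinct branches. The pair `x`,
      -- `z` is one, and it is excluded through `y≁K`.
      ... | u∈I , u≢v , u≢x | yes refl = y≁K u∈K y~z

      w≁y∪K : ∀ {u} → u ∈ ⁅ y ⁆ ∪ K → ¬ w ~ u
      w≁y∪K u∈ with ∈⁅⁆∪⁻ u∈
      ... | inj₁ refl = w≁y
      ... | inj₂ u∈K  = w≁K u∈K

      J-indep : Independent G J
      J-indep = independent-∪ G (∈V v~w)
        (independent-∪ G (∈V v~y) (independent-∖ G x (independent-∖ G v I-indep)) y≁K) w≁y∪K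

      w∉y∪K : w ∉ ⁅ y ⁆ ∪ K
      w∉y∪K w∈ with ∈⁅⁆∪⁻ w∈
      ... | inj₁ w≡y = y≢w (sym w≡y)
      ... | inj₂ w∈K = ∉I v~w (proj₁ (K⁻ w∈K))

      open ≤-Reasoning
      ∣I∣≤∣J∣ : ∣ I ∣ ≤ ∣ J ∣
      ∣I∣≤∣J∣ = begin
        ∣ I ∣             ≤⟨ ∣p∣≤1+∣p∖v∣ I v ⟩
        suc ∣ I ∖ v ∣     ≤⟨ s≤s (∣p∣≤1+∣p∖v∣ (I ∖ v) x) ⟩
        suc (suc ∣ K ∣)   ≤⟨ s≤s (v∉p⇒∣p∣<∣⁅v⁆∪p∣ λ y∈K → ∉I v~y (proj₁ (K⁻ y∈K))) ⟩
        suc ∣ ⁅ y ⁆ ∪ K ∣ ≤⟨ v∉p⇒∣p∣<∣⁅v⁆∪p∣ w∉y∪K ⟩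
        ∣ J ∣             ∎

    exchange-∈ : HasEdge G → Exchange
    exchange-∈ edge with maxDegreeNeighbour G v-max edge
    ... | w , v~w with any? (λ x → x ∈? I ×-dec ¬? (x ≟ v) ×-dec w ~? x)
    ...   | no noOther = exchangeOne v~w noOther
    ...   | yes (x , x∈I , x≢v , w~x)
      with neighbourAvoiding G v-max v~w w~x x≢v (I-free v x v∈I x∈I)
    ...     | y , v~y , y≢w , w≁y with any? (λ z → z ∈? I ×-dec ¬? (z ≟ v) ×-dec y ~? z)
    ...       | no noOther = exchangeOne v~y noOther
    ...       | yes (z , z∈I , z≢v , y~z) =
      exchangeTwo v~w v~y y≢w w≁y x∈I x≢v w~x z∈I z≢v y~z

  -- A set avoiding `v` survives the deletion as it is, so only the case `v ∈ I` calls for an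
  -- exchange.
  exchange : ∀ {v I} → HasMaxDegree G v → HasEdge G → Independent G I →
             ∃ λ J → Independent (deleteVertex G v) J × ∣ I ∣ ≤ ∣ J ∣
  exchange {v} {I} v-max edge I-indep with v ∈? I
  ... | no v∉I  = I , independent-delete⁺ G v∉I I-indep , ≤-refl
  ... | yes v∈I = exchange-∈ v-max I-indep v∈I edge

-- Sorted lists and single steps of the Havel-Hakimi algorithm.

private
  module ≥ = DecTotalOrder (decTotalOrder ≤-decTotalOrder)

open Sorted ≥.totalOrder using (Sorted)

sorted-unique : ∀ {xs ys} → Sorted xs → Sorted ys → xs ↭ ys → xs ≡ ys
sorted-unique xs↗ ys↗ xs↭ys = Pointwise.Pointwise-≡⇒≡
  (↗↭↗⇒≋ ≥.totalOrder xs↗ ys↗ (↭⇒↭ₛ′ ≥.Eq.isEquivalence xs↭ys))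

sort-cong-↭ : ∀ {xs ys} → xs ↭ ys → sort xs ≡ sort ys
sort-cong-↭ {xs} {ys} xs↭ys = sorted-unique (sort-↗ xs) (sort-↗ ys)
  (↭-trans (sort-↭ xs) (↭-trans xs↭ys (↭-sym (sort-↭ ys))))

-- Needed because `residue` sorts its argument again, although `degreeSequence` is sorted already.
sort-idem : ∀ xs → sort (sort xs) ≡ sort xs
sort-idem xs = sort-cong-↭ (sort-↭ xs)

take-length-++ : {A : Set} (xs {ys} : List A) → take (length xs) (xs ++ ys) ≡ xs
take-length-++ []       = refl
take-length-++ (x ∷ xs) = cong (x ∷_) (take-length-++ xs)

drop-length-++ : {A : Set} (xs {ys} : List A) → drop (length xs) (xs ++ ys) ≡ ys
drop-length-++ []       = refl
drop-length-++ (x ∷ xs) = drop-length-++ xs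

-- Once the `t` terms after the head form a block of their own, `take` and `drop` return exactly the
-- two blocks.
havelHakimiStep-++ : ∀ {t} xs ys → length xs ≡ t →
                     havelHakimiStep (t ∷ xs ++ ys) ≡ sort (map pred xs ++ ys)
havelHakimiStep-++ xs ys refl =
  cong₂ (λ as bs → sort (map pred as ++ bs)) (take-length-++ xs) (drop-length-++ xs)

havelHakimi-suc : ∀ k {ds} → ¬ All (_≡ 0) ds →
                  havelHakimi (suc k) ds ≡ havelHakimi k (havelHakimiStep ds)
havelHakimi-suc k {ds} nonzero with all? (_≟ℕ 0) ds
... | yes zeros = contradiction zeros nonzero
... | no _      = refl

havelHakimi-zeros : ∀ k {ds} → All (_≡ 0) ds → havelHakimi k ds ≡ ds
havelHakimi-zeros zero    zeros = refl
havelHakimi-zeros (suc k) {ds} zeros with all? (_≟ℕ 0) ds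
... | yes _       = refl
... | no nonzeros = contradiction zeros nonzeros

-- The step bounds match: `residue ds` allows `length ds` steps, and after one of them the number
-- left is the bound `length es` with which `residue es` starts.
residue-step : ∀ {ds es} → sort ds ≡ ds → sort es ≡ es → length ds ≡ suc (length es) →
               ¬ All (_≡ 0) ds → havelHakimiStep ds ≡ es → residue ds ≡ residue es
residue-step {ds} {es} ds↗ es↗ len nonzero step
  rewrite ds↗ | es↗ | len | havelHakimi-suc (length es) nonzero | step = refl

residue-zeros : ∀ {ds} → sort ds ≡ ds → All (_≡ 0) ds → residue ds ≡ length ds
residue-zeros {ds} ds↗ zeros rewrite ds↗ | havelHakimi-zeros (length ds) zeros =
  cong length (filter-all (_≟ℕ 0) zeros)

map-cong-All : {A B : Set} {f g : A → B} {xs : List A} →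
               All (λ x → f x ≡ g x) xs → map f xs ≡ map g xs
map-cong-All []         = refl
map-cong-All (eq ∷ eqs) = cong₂ _∷_ eq (map-cong-All eqs)

-- The degree sequence and the residue under deletion of a vertex.

length-degreeSequence : (G : Graph n) → length (degreeSequence G) ≡ ∣ V G ∣
length-degreeSequence G = trans (↭-length (sort-↭ (degrees G)))
  (trans (length-map (deg G) (vertices G))
  (trans (length-filter-tabulate (_∈? V G) (λ v → v))
    (cong ∣_∣ (⊆-antisym (∈-tabulate⁻ (_∈? V G)) (∈-tabulate⁺ (_∈? V G))))))

module _ (G : Graph n) {v : Fin n} (hh : HavelHakimiProperty G v) where
  open Graph G using (_~_; _~?_; ~-sym; ~-irrefl; ~⇒∈V)

  private
    G-v = deleteVertex G v

    v∈V : v ∈ V G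
    v∈V = proj₁ (proj₁ hh)

    Far : Fin n → Set
    Far u = u ∈ V G × u ≢ v × ¬ v ~ u

    far? : Decidable Far
    far? u = u ∈? V G ×-dec ¬? (u ≟ v) ×-dec ¬? (v ~? u)

    near far : List (Fin n)
    near = filter (v ~?_) (allFin n)
    far  = filter far? (allFin n)

    sortedNear sortedFar : List ℕ
    sortedNear = sort (map (deg G) near)
    sortedFar  = sort (map (deg G) far)

    near∪far! : Unique (near ++ far)
    near∪far! = Unique.++⁺ (Unique.filter⁺ (v ~?_) (Unique.allFin⁺ n))
      (Unique.filter⁺ far? (Unique.allFin⁺ n))
      λ (u∈near , u∈far) → proj₂ (proj₂ (proj₂ (∈-filter⁻ far? {xs = allFin n} u∈far)))
        (proj₂ (∈-filter⁻ (v ~?_) {xs = allFin n} u∈near))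

    near∪far⁻ : ∀ {u} → u ∈ₗ near ++ far → u ∈ V G × u ≢ v
    near∪far⁻ u∈ with ∈-++⁻ near u∈
    ... | inj₁ u∈near with ∈-filter⁻ (v ~?_) {xs = allFin n} u∈near
    ...   | _ , v~u = ~⇒∈V (~-sym v~u) , λ u≡v → ~-irrefl (sym u≡v) v~u
    near∪far⁻ u∈ | inj₂ u∈far with ∈-filter⁻ far? {xs = allFin n} u∈far
    ... | _ , u∈V , u≢v , _ = u∈V , u≢v

    near∪far⁺ : ∀ {u} → u ∈ V G → u ≢ v → u ∈ₗ near ++ far
    near∪far⁺ {u} u∈V u≢v with v ~? u
    ... | yes v~u = ∈-++⁺ˡ (∈-filter⁺ (v ~?_) (∈-allFin u) v~u)
    ... | no v≁u  = ∈-++⁺ʳ near (∈-filter⁺ far? (∈-allFin u) (u∈V , u≢v , v≁u))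

    -- Both lists are free of duplicates and have the same members, which makes them permutations of
    -- each other.
    vertices↭ : vertices G ↭ v ∷ near ++ far
    vertices↭ = ∼bag⇒↭ (unique∧set⇒bag (Unique.filter⁺ (_∈? V G) (Unique.allFin⁺ n))
      (All.tabulate (λ u∈ v≡u → proj₂ (near∪far⁻ u∈) (sym v≡u)) ∷ near∪far!)
      (mk⇔ to from))
      where
      to : ∀ {u} → u ∈ₗ vertices G → u ∈ₗ v ∷ near ++ far
      to {u} u∈ with u ≟ v
      ... | yes u≡v = here u≡v
      ... | no u≢v  = there (near∪far⁺ (proj₂ (∈-filter⁻ (_∈? V G) {xs = allFin n} u∈)) u≢v)
      from : ∀ {u} → u ∈ₗ v ∷ near ++ far → u ∈ₗ vertices G
      from {u} (here refl) = ∈-filter⁺ (_∈? V G) (∈-allFin u) v∈V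
      from {u} (there u∈)  = ∈-filter⁺ (_∈? V G) (∈-allFin u) (proj₁ (near∪far⁻ u∈))

    vertices-v↭ : vertices G-v ↭ near ++ far
    vertices-v↭ = ∼bag⇒↭ (unique∧set⇒bag (Unique.filter⁺ (_∈? V G-v) (Unique.allFin⁺ n))
      near∪far! (mk⇔ to from))
      where
      to : ∀ {u} → u ∈ₗ vertices G-v → u ∈ₗ near ++ far
      to u∈ with ∈∖⁻ (proj₂ (∈-filter⁻ (_∈? V G-v) {xs = allFin n} u∈))
      ... | u∈V , u≢v = near∪far⁺ u∈V u≢v
      from : ∀ {u} → u ∈ₗ near ++ far → u ∈ₗ vertices G-v
      from {u} u∈ with near∪far⁻ u∈
      ... | u∈V , u≢v = ∈-filter⁺ (_∈? V G-v) (∈-allFin u) (∈∖⁺ u∈V u≢v)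

    length-sortedNear : length sortedNear ≡ deg G v
    length-sortedNear = trans (↭-length (sort-↭ (map (deg G) near)))
      (trans (length-map (deg G) near) (length-filter-tabulate (v ~?_) (λ u → u)))

    All-sort : {P : ℕ → Set} (us : List (Fin n)) → (∀ {u} → u ∈ₗ us → P (deg G u)) →
               All P (sort (map (deg G) us))
    All-sort us P-us = All-resp-↭ (↭-sym (sort-↭ (map (deg G) us))) (All.map⁺ (All.tabulate P-us))

    near≥far : All (λ d → All (_≤ d) sortedFar) sortedNear
    near≥far = All-sort near λ w∈ → All-sort far λ u∈ →
      compare (∈-filter⁻ (v ~?_) {xs = allFin n} w∈) (∈-filter⁻ far? {xs = allFin n} u∈)
      where
      compare : ∀ {w u} → w ∈ₗ allFin n × v ~ w → u ∈ₗ allFin n × Far u → deg G u ≤ deg G w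
      compare (_ , v~w) (_ , u∈V , u≢v , v≁u) = proj₂ hh _ _ v~w u∈V u≢v v≁u

    ≤deg-v : All (_≤ deg G v) (sortedNear ++ sortedFar)
    ≤deg-v = All.++⁺
      (All-sort near λ u∈ → proj₂ (proj₁ hh) _ (proj₁ (near∪far⁻ (∈-++⁺ˡ u∈))))
      (All-sort far λ u∈ → proj₂ (proj₁ hh) _ (proj₁ (near∪far⁻ (∈-++⁺ʳ near u∈))))

    N-delete : ∀ {u} → u ≢ v → N G-v u ≡ N G u ∖ v
    N-delete {u} u≢v = ⊆-antisym ⊆₁ ⊆₂
      where
      ⊆₁ : N G-v u ⊆ N G u ∖ v
      ⊆₁ t∈ with ∈N⁻ G-v t∈
      ... | u~t , _ , t∈∁ = x∈p∩q⁺ (∈N⁺ G u~t , t∈∁)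
      ⊆₂ : N G u ∖ v ⊆ N G-v u
      ⊆₂ t∈ with ∈∖⁻ t∈
      ... | t∈N , t≢v = ∈N⁺ G-v (∈N⁻ G t∈N , ∈∁⁅⁆⁺ u≢v , ∈∁⁅⁆⁺ t≢v)

    -- Adjacency puts `v` into `N G u`, so `deg G u` is positive and the truncation in `pred` does
    -- not occur.
    deg-near : ∀ {u} → v ~ u → pred (deg G u) ≡ deg G-v u
    deg-near {u} v~u = trans
      (cong pred (≤-antisym (∣p∣≤1+∣p∖v∣ (N G u) v) (v∈p⇒∣p∖v∣<∣p∣ (∈N⁺ G (~-sym v~u)))))
      (sym (cong ∣_∣ (N-delete λ u≡v → ~-irrefl (sym u≡v) v~u)))

    deg-far : ∀ {u} → u ≢ v → ¬ v ~ u → deg G u ≡ deg G-v u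
    deg-far {u} u≢v v≁u = cong ∣_∣ (sym (trans (N-delete u≢v)
      (⊆-antisym (λ t∈ → proj₁ (∈∖⁻ t∈))
        λ t∈ → ∈∖⁺ t∈ λ { refl → v≁u (~-sym (∈N⁻ G t∈)) })))

  -- Maximality of `deg G v` and the Havel-Hakimi property, in the form `near≥far`, make the
  -- right-hand side sorted. It is a permutation of the degrees, and a sorted permutation is unique.
  degreeSequence-split : degreeSequence G ≡ deg G v ∷ sortedNear ++ sortedFar
  degreeSequence-split = sorted-unique (sort-↗ (degrees G))
    (AllPairs⇒Sorted ≥.totalOrder (≤deg-v ∷ AllPairs.++⁺
      (Sorted⇒AllPairs ≥.totalOrder (sort-↗ (map (deg G) near)))
      (Sorted⇒AllPairs ≥.totalOrder (sort-↗ (map (deg G) far))) near≥far))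
    (↭-trans (sort-↭ (degrees G)) (↭-trans (Perm.map⁺ (deg G) vertices↭) (↭-prep (deg G v)
      (subst (_↭ sortedNear ++ sortedFar) (sym (map-++ (deg G) near far))
        (Perm.++⁺ (↭-sym (sort-↭ (map (deg G) near))) (↭-sym (sort-↭ (map (deg G) far))))))))

  -- The block `sortedNear` has length `deg G v`, so the step lowers precisely the degrees of the
  -- neighbours of `v` and keeps the others, just as deleting `v` does.
  havelHakimiStep-degreeSequence :
    havelHakimiStep (degreeSequence G) ≡ degreeSequence (deleteVertex G v)
  havelHakimiStep-degreeSequence = trans (cong havelHakimiStep degreeSequence-split)
    (trans (havelHakimiStep-++ sortedNear sortedFar length-sortedNear)
      (sort-cong-↭ (↭-trans
        (Perm.++⁺ (Perm.map⁺ pred (sort-↭ (map (deg G) near))) (sort-↭ (map (deg G) far)))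
        (subst (_↭ degrees G-v) (sym reduced) (↭-sym (Perm.map⁺ (deg G-v) vertices-v↭))))))
    where
    reduced : map pred (map (deg G) near) ++ map (deg G) far ≡ map (deg G-v) (near ++ far)
    reduced = trans
      (cong₂ _++_
        (trans (sym (map-∘ near))
          (map-cong-All (All.map deg-near (All.all-filter (v ~?_) (allFin n)))))
        (map-cong-All (All.map (λ (_ , u≢v , v≁u) → deg-far u≢v v≁u)
          (All.all-filter far? (allFin n)))))
      (sym (map-++ (deg G-v) near far))

  length-degreeSequence-delete :
    length (degreeSequence G) ≡ suc (length (degreeSequence (deleteVertex G v)))
  length-degreeSequence-delete = trans (length-degreeSequence G)
    (trans (≤-antisym (∣p∣≤1+∣p∖v∣ (V G) v) (v∈p⇒∣p∖v∣<∣p∣ v∈V))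
      (cong suc (sym (length-degreeSequence G-v))))

  residue-delete : HasEdge G → R G ≡ R (deleteVertex G v)
  residue-delete edge = residue-step (sort-idem (degrees G)) (sort-idem (degrees G-v)) length-degreeSequence-delete
    nonzero havelHakimiStep-degreeSequence
    where
    -- The head of the sequence is `deg G v`, which is at least 1 because `v` has a neighbour as
    -- soon as there is an edge.
    nonzero : ¬ All (_≡ 0) (degreeSequence G)
    nonzero zeros = contradiction
      (≤-trans (length≤deg G ([] ∷ []) (proj₂ (maxDegreeNeighbour G (proj₁ hh) edge) ∷ []))
               (≤-reflexive (All.head (subst (All (_≡ 0)) degreeSequence-split zeros))))
      1+n≰n

residue-edgeless : (G : Graph n) → ¬ HasEdge G → R G ≡ ∣ V G ∣
residue-edgeless G edgeless = trans
  (residue-zeros (sort-idem (degrees G))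
    (All-resp-↭ (↭-sym (sort-↭ (degrees G)))
      (All.map⁺ (All.tabulate {xs = vertices G} λ {u} _ → ≤-antisym
        (deg≤length G {v = u} [] λ u~w → contradiction (_ , _ , u~w) edgeless) z≤n))))
  (length-degreeSequence G)

-- The independence number and the runs of Maxine.

∈-allSubsets : (S : Subset n) → S ∈ₗ allSubsets n
∈-allSubsets Vec.[] = here refl
∈-allSubsets (outside Vec.∷ S) = ∈-++⁺ˡ (∈-map⁺ (outside Vec.∷_) (∈-allSubsets S))
∈-allSubsets {suc n} (inside Vec.∷ S) =
  ∈-++⁺ʳ (map (outside Vec.∷_) (allSubsets n)) (∈-map⁺ (inside Vec.∷_) (∈-allSubsets S))

α-maximum : (G : Graph n) {S : Subset n} → MaximumIndependent G S → α G ≡ ∣ S ∣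
α-maximum {n} G {S} (S-indep , S-max) = max≈v⁺
  (∈-map⁺ ∣_∣ (∈-filter⁺ (independent? G) (∈-allSubsets S) S-indep))
  (All.map⁺ (All.map (λ {T} → S-max T) (All.all-filter (independent? G) (allSubsets n))))
  -- This bounds the default value 0 of `max` by `∣ S ∣`.
  z≤n

-- A vertex-deleted graph is not a structural part of the graph, so the recursion runs on a bound
-- `k` for the number of vertices.
maxine-run : ∀ k (G : Graph n) → ∣ V G ∣ ≤ k → ∃ (Maxine G)
maxine-run k G ∣V∣≤k with hasEdge? G
... | no edgeless = V G , stop edgeless
... | yes edge@(_ , _ , a~b) with maxDegreeVertex G (Graph.~⇒∈V G a~b)
-- The vertex `v` lies in `V G`, so `k` is not zero, and its predecessor bounds the number of
-- vertices left after deletion.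
...   | v , v-max with k | ≤-trans (v∈p⇒∣p∖v∣<∣p∣ (proj₁ v-max)) ∣V∣≤k
...     | suc k′ | s≤s ∣V∖v∣≤k′ with maxine-run k′ (deleteVertex G v) ∣V∖v∣≤k′
...       | S , run = S , delete edge v-max run

-- Induction on the run. For a deletion, `exchange` turns each independent set of `G` into one of
-- `deleteVertex G v` that is at least as large, and the induction hypothesis bounds the latter by
-- `∣ S ∣`.
maxine-correct : {G : Graph n} {S : Subset n} → StrongHavelHakimiProperty G → Maxine G S →
                 R G ≡ ∣ S ∣ × MaximumIndependent G S
maxine-correct {G = G} strong (stop edgeless) =
  residue-edgeless G edgeless ,
  ((λ u∈V → u∈V) , λ u v _ _ u~v → edgeless (u , v , u~v)) ,
  λ T (T⊆V , _) → p⊆q⇒∣p∣≤∣q∣ T⊆V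
maxine-correct {G = G} {S} strong (delete {v} edge v-max run)
  with maxine-correct (strong-[] {G = G} strong (∁ ⁅ v ⁆)) run
... | R≡∣S∣ , S-indep , S-max =
  trans (residue-delete G (strong⇒havelHakimi {G = G} strong v-max) edge) R≡∣S∣ ,
  independent-delete⁻ G S-indep ,
  bound
  where
  bound : ∀ T → Independent G T → ∣ T ∣ ≤ ∣ S ∣
  bound T T-indep with exchange {G = G} strong v-max edge T-indep
  ... | J , J-indep , ∣T∣≤∣J∣ = ≤-trans ∣T∣≤∣J∣ (S-max J J-indep)

theorem5 : ∀ {n : ℕ} (G : Graph n) → StrongHavelHakimiProperty G →
    (R G ≡ α G) × (∀ S → Maxine G S → MaximumIndependent G S)
-- The equality of `R G` and `α G` is read off from the outcome of one run, so a run has to be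
-- exhibited first.
theorem5 G strong with maxine-run ∣ V G ∣ G ≤-refl
... | S , run with maxine-correct {G = G} strong run
...   | R≡∣S∣ , S-max =
  trans R≡∣S∣ (sym (α-maximum G S-max)) , λ T run → proj₂ (maxine-correct {G = G} strong run)
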